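{- Let $G=(U,V,E)$ be a finite bipartite graph with $|U|\le |V|$. Let $v\in U$, and let $w_{vu}=|N(v)\cap N(u)|$ for all $u\in U$ (including $u=v$). Let $y_v$ be the maximum integer such that there exist at least $y_v$ vertices $u\in U$ satisfying $w_{vu}\ge y_v$. Then $y_v$ is an upper bound on the half-size of a maximum balanced biclique involving $v$; that is, every balanced biclique $(A,B)$ of $G$ with $v\in A$ satisfies $|A|=|B|\le y_v$.
   Context: A bipartite graph $G=(U,V,E)$ has two disjoint finite vertex sets $U,V$ and an edge set $E\subseteq U\times V$ (edges written as unordered pairs $\{u,v\}$ with $u\in U$, $v\in V$). For a vertex $v$, $N(v)=\{u:\{v,u\}\in E\}$ is its set of neighbours. A biclique is a pair $(A,B)$ with $A\subseteq U$, $B\subseteq V$ such that $\{u,v\}\in E$ for all $u\in A$, $v\in B$. It is balanced if $|A|=|B|$, and its half-size is then $|A|$. -}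

module Defs where

open import Data.Fin.Base using (Fin)
open import Data.Fin.Subset using (Subset; _∈_; _∩_; ∣_∣)
open import Data.Fin.Subset.Properties using (∣p∣≤n)
open import Data.Nat.Base using (ℕ; zero; suc; _≤_; z≤n; s≤s⁻¹)
open import Data.Nat.Properties using (_≤?_; ≤-trans; m≤n⇒m<n∨m≡n)
open import Data.Product.Base using (∃; _×_; _,_)
open import Data.Sum.Base using (inj₁; inj₂)
open import Data.Vec.Base using (tabulate)
open import Function.Base using (_∘_)
open import Level using (0ℓ)
open import Relation.Binary.Core using (REL)
import Relation.Binary.Definitions as Binary
open import Relation.Binary.PropositionalEquality.Core using (_≡_; refl)
open import Relation.Nullary.Decidable.Core using (does; yes; no)
open import Relation.Nullary.Negation.Core using (contradiction)
open import Relation.Unary using (Pred; Decidable)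

record BipartiteGraph (m n : ℕ) : Set₁ where
  field
    E  : REL (Fin m) (Fin n) 0ℓ
    E? : Binary.Decidable E

⟪_⟫ : ∀ {n} {P : Pred (Fin n) 0ℓ} → Decidable P → Subset n
⟪ P? ⟫ = tabulate (does ∘ P?)

IsMaximumOf : Pred ℕ 0ℓ → ℕ → Set
IsMaximumOf P y = P y × (∀ z → P z → z ≤ y)

module _ {m n : ℕ} (G : BipartiteGraph m n) where
  open BipartiteGraph G

  N : Fin m → Subset n
  N u = ⟪ E? u ⟫

  w : Fin m → Fin m → ℕ
  w v u = ∣ N v ∩ N u ∣

  -- At least y vertices u, possibly including v itself, satisfy w v u ≥ y.
  -- Natural numbers suffice for the maximum: y = 0 always qualifies.
  AtLeast : Fin m → Pred ℕ 0ℓ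
  AtLeast v y = y ≤ ∣ ⟪ (λ u → y ≤? w v u) ⟫ ∣

  IsY : Fin m → ℕ → Set
  IsY v = IsMaximumOf (AtLeast v)

  record BalancedBiclique : Set where
    field
      A        : Subset m
      B        : Subset n
      biclique : ∀ {u v} → u ∈ A → v ∈ B → E u v
      balanced : ∣ A ∣ ≡ ∣ B ∣

    halfSize : ℕ
    halfSize = ∣ A ∣

maximum-exists : ∀ {P : Pred ℕ 0ℓ} → Decidable P → P 0 →
                 ∀ b → (∀ z → P z → z ≤ b) → ∃ (IsMaximumOf P)
maximum-exists P? p₀ zero    bound = 0 , p₀ , bound
maximum-exists {P} P? p₀ (suc b) bound with P? (suc b)
... | yes p = suc b , p , bound
... | no ¬p = maximum-exists P? p₀ b bound′
  where
  bound′ : ∀ z → P z → z ≤ b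
  bound′ z pz with m≤n⇒m<n∨m≡n (bound z pz)
  ... | inj₁ z<1+b = s≤s⁻¹ z<1+b
  ... | inj₂ refl  = contradiction pz ¬p

-- The defining maximum is always attained, so IsY is never vacuous.
IsY-exists : ∀ {m n} (G : BipartiteGraph m n) v → ∃ (IsY G v)
IsY-exists {m} G v =
  maximum-exists (λ y → y ≤? _) z≤n m
    (λ z p → ≤-trans p (∣p∣≤n ⟪ (λ u → z ≤? w G v u) ⟫))

{-# OPTIONS --safe #-}
module Submission where

open import Defs
open import Data.Fin.Base using (Fin)
open import Data.Fin.Subset using (_∈_)
open import Data.Fin.Subset.Properties using (p⊆q⇒∣p∣≤∣q∣; x∈p∩q⁺)
open import Data.Nat.Base using (ℕ; _≤_)
open import Data.Nat.Properties using (_≤?_; ≤-reflexive; ≤-trans)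
open import Data.Product.Base using (_,_)
open import Data.Vec.Properties using (lookup∘tabulate; lookup⇒[]=)
open import Function.Base using (_∘_)
open import Level using (0ℓ)
open import Relation.Binary.PropositionalEquality using (trans)
open import Relation.Nullary.Decidable using (does; dec-true)
open import Relation.Unary using (Pred; Decidable)

-- For a balanced biclique (A, B) with v ∈ A, every u ∈ A has B ⊆ N(v) ∩ N(u),
-- so the |A| vertices of A all satisfy w v u ≥ |B| = |A|; hence |A| is one of
-- the numbers over which y_v is the maximum.

∈-⟪⟫⁺ : ∀ {n} {P : Pred (Fin n) 0ℓ} (P? : Decidable P) {x} → P x → x ∈ ⟪ P? ⟫
∈-⟪⟫⁺ P? {x} px =
  lookup⇒[]= x ⟪ P? ⟫
    (trans (lookup∘tabulate (does ∘ P?) x) (dec-true (P? x) px))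

module _ {m n : ℕ} (G : BipartiteGraph m n) (K : BalancedBiclique G) where
  open BipartiteGraph G
  open BalancedBiclique K

  halfSize≤w : ∀ {v u} → v ∈ A → u ∈ A → halfSize ≤ w G v u
  halfSize≤w {v} {u} v∈A u∈A =
    -- The common neighbours of `v` and `u` contain `B`, not `A`, so `balanced` first trades the
    -- size of `A` for that of `B`.
    ≤-trans (≤-reflexive balanced) (p⊆q⇒∣p∣≤∣q∣ λ b∈B →
      x∈p∩q⁺ (∈-⟪⟫⁺ (E? v) (biclique v∈A b∈B) , ∈-⟪⟫⁺ (E? u) (biclique u∈A b∈B)))

  atLeast-halfSize : ∀ {v} → v ∈ A → AtLeast G v halfSize
  atLeast-halfSize {v} v∈A =
    -- In `AtLeast`, `halfSize` is both threshold and count. As a count it unfolds to the size of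
    -- `A`, so it suffices that `A` lies inside the set of vertices meeting the threshold.
    p⊆q⇒∣p∣≤∣q∣ (∈-⟪⟫⁺ (λ u → halfSize ≤? w G v u) ∘ halfSize≤w v∈A)

proposition2 : ∀ {m n : ℕ} (G : BipartiteGraph m n) → m ≤ n →
    (v : Fin m) (y : ℕ) → IsY G v y →
    (K : BalancedBiclique G) → v ∈ BalancedBiclique.A K →
    BalancedBiclique.halfSize K ≤ y
proposition2 G _ v y (_ , maximal) K v∈A = maximal _ (atLeast-halfSize G K v∈A)
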